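{- Let $\rho:|G|\hookrightarrow GL(V)$ with $\dim_{\mathbb R} V=3$ be a faithful representation of a finite group $|G|$ such that the linear group $\rho(|G|)$ is strictly generated in codimension two. For $n\ge 1$, let $\operatorname{diag}_nG$ be the linear group given by the faithful representation $$|G|\xrightarrow{\ \rho\times\dots\times\rho\ }GL(V^n),$$ i.e. $g$ acts on $V^n=V\times\dots\times V$ by $\rho(g)$ on each factor. Then $\operatorname{diag}_nG$ is a linear group of rank $3n$ that is strictly generated in codimension $2n$.
   Context: For a finite linear group $G\subset GL(U)$ on a finite-dimensional real vector space $U$, the rank of $G$ is $\dim U$; for $g\in G$, $U^{\langle g\rangle}$ is the subspace of vectors fixed by $g$. $G$ is strictly generated in codimension $k$ if it is generated by its elements $g$ with $\operatorname{codim}U^{\langle g\rangle}=k$. -}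

module Defs where

open import Algebra.Bundles using (AbelianGroup; CommutativeRing; Group)
open import Algebra.Construct.Pointwise using () renaming (abelianGroup to pointwiseAbelianGroup)
open import Algebra.Module.Bundles using (Module)
open import Algebra.Module.Morphism.Structures using (IsModuleIsomorphism)
import Algebra.Module.Morphism.Construct.Composition as Composition
import Algebra.Module.Morphism.Construct.Identity as Identity
import Algebra.Module.Morphism.ModuleMonomorphism as ModuleMonomorphism
import Algebra.Properties.AbelianGroup as AbelianGroupProperties
import Algebra.Properties.CommutativeMonoid.Sum as Sum
import Algebra.Properties.CommutativeSemigroup as CommutativeSemigroupProperties
import Algebra.Properties.Ring as RingProperties
open import Algebra.Morphism.Structures using (IsGroupMonomorphism)
open import Algebra.Structures using (IsAbelianGroup)
open import Data.Fin.Base using (Fin)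
open import Data.Nat.Base as ℕ using (ℕ; _⊔_) renaming (_≤_ to _≤ⁿ_)
import Data.Nat.Properties as ℕ
open import Data.Product.Base using (∃; ∃₂; _×_; _,_; proj₁; proj₂)
open import Data.Rational.Base
  using (ℚ; 0ℚ; 1ℚ; ½; _+_; _*_; -_; _-_; ∣_∣; _<_; 1/_; positive)
open import Data.Rational.Properties as ℚ using (positive⁻¹)
open import Data.Vec.Functional using (Vector)
open import Function.Base using (_∘_; id)
open import Function.Bundles using (Inverse)
open import Level using (Level) renaming (_⊔_ to _⊔ˡ_; suc to lsuc)
open import Relation.Binary.Bundles using (Setoid)
open import Relation.Binary.PropositionalEquality.Core
  using (_≡_; refl; sym; trans; cong; cong₂; subst)
open import Relation.Binary.PropositionalEquality.Properties using (setoid)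
open import Relation.Unary using (Pred; _∈_; _≐_; _∩_)

-- ℝ is the setoid of Cauchy sequences of rationals; two of them are equal
-- when their difference tends to 0.

IsCauchy : (ℕ → ℚ) → Set
IsCauchy s = ∀ ε → 0ℚ < ε → ∃ λ N → ∀ m n → N ≤ⁿ m → N ≤ⁿ n → ∣ s m - s n ∣ < ε

record ℝ : Set where
  constructor mkℝ
  field
    seq    : ℕ → ℚ
    cauchy : IsCauchy seq

open ℝ

infix 4 _≈ʳ_

_≈ʳ_ : ℝ → ℝ → Set
x ≈ʳ y = ∀ ε → 0ℚ < ε → ∃ λ N → ∀ n → N ≤ⁿ n → ∣ seq x n - seq y n ∣ < ε

-- Null families, over any index type filtered by a decreasing sequence of
-- tails.  It is used for I = ℕ (equality) and I = ℕ × ℕ (Cauchy condition).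
private
  open AbelianGroupProperties ℚ.+-0-abelianGroup using (xyx⁻¹≈y; ⁻¹-anti-homo‿-)
  open CommutativeSemigroupProperties
    (AbelianGroup.commutativeSemigroup ℚ.+-0-abelianGroup) using (interchange)
  open RingProperties ℚ.+-*-ring using (x[y-z]≈xy-xz)

  halve : ∀ {ε} → 0ℚ < ε → 0ℚ < ½ * ε
  halve {ε} 0<ε = subst (_< ½ * ε) (ℚ.*-zeroʳ ½) (ℚ.*-monoʳ-<-pos ½ 0<ε)

  half+half : ∀ ε → ½ * ε + ½ * ε ≡ ε
  half+half ε = trans (sym (ℚ.*-distribʳ-+ ε ½ ½)) (ℚ.*-identityˡ ε)

  module Null {I : Set} (Tail : ℕ → I → Set)
              (weaken : ∀ {M N i} → M ≤ⁿ N → Tail N i → Tail M i) where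

    IsNull : (I → ℚ) → Set
    IsNull z = ∀ ε → 0ℚ < ε → ∃ λ N → ∀ i → Tail N i → ∣ z i ∣ < ε

    Bounded : (I → ℚ) → Set
    Bounded z = ∃ λ B → 0ℚ < B × ∃ λ N → ∀ i → Tail N i → ∣ z i ∣ < B

    null-≗ : ∀ y z → (∀ i → y i ≡ z i) → IsNull y → IsNull z
    null-≗ y z eq nully ε 0<ε with N , h ← nully ε 0<ε =
      N , λ i t → subst (λ q → ∣ q ∣ < ε) (eq i) (h i t)

    null-0 : ∀ z → (∀ i → z i ≡ 0ℚ) → IsNull z
    null-0 z eq ε 0<ε = 0 , λ i _ → subst (λ q → ∣ q ∣ < ε) (sym (eq i)) 0<ε

    null-neg : ∀ z → IsNull z → IsNull (λ i → - z i)
    null-neg z nullz ε 0<ε with N , h ← nullz ε 0<ε =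
      N , λ i t → subst (_< ε) (sym (ℚ.∣-p∣≡∣p∣ (z i))) (h i t)

    null-+ : ∀ y z → IsNull y → IsNull z → IsNull (λ i → y i + z i)
    null-+ y z nully nullz ε 0<ε
      with M , f ← nully (½ * ε) (halve 0<ε) | N , g ← nullz (½ * ε) (halve 0<ε) =
      M ⊔ N , λ i t → ℚ.≤-<-trans (ℚ.∣p+q∣≤∣p∣+∣q∣ (y i) (z i))
        (subst (∣ y i ∣ + ∣ z i ∣ <_) (half+half ε)
          (ℚ.+-mono-< (f i (weaken (ℕ.m≤m⊔n M N) t)) (g i (weaken (ℕ.m≤n⊔m M N) t))))

    null-* : ∀ y z → Bounded y → IsNull z → IsNull (λ i → y i * z i)
    null-* y z (B , 0<B , M , f) nullz ε 0<ε = M ⊔ N , bound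
      where
      instance
        B-pos = positive 0<B
        B-nonZero = ℚ.pos⇒nonZero B
        1/B-pos = ℚ.1/pos⇒pos B

      δ = 1/ B * ε

      0<δ : 0ℚ < δ
      0<δ = subst (_< δ) (ℚ.*-zeroʳ (1/ B)) (ℚ.*-monoʳ-<-pos (1/ B) 0<ε)

      Bδ≡ε : B * δ ≡ ε
      Bδ≡ε = trans (sym (ℚ.*-assoc B (1/ B) ε))
               (trans (cong (_* ε) (ℚ.*-inverseʳ B)) (ℚ.*-identityˡ ε))

      N = proj₁ (nullz δ 0<δ)

      bound : ∀ i → Tail (M ⊔ N) i → ∣ y i * z i ∣ < ε
      bound i t = begin-strict
        ∣ y i * z i ∣      ≡⟨ ℚ.∣p*q∣≡∣p∣*∣q∣ (y i) (z i) ⟩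
        ∣ y i ∣ * ∣ z i ∣  ≤⟨ ℚ.*-monoʳ-≤-nonNeg ∣ z i ∣ {{ℚ.∣-∣-nonNeg (z i)}}
                                (ℚ.<⇒≤ (f i (weaken (ℕ.m≤m⊔n M N) t))) ⟩
        B * ∣ z i ∣        <⟨ ℚ.*-monoʳ-<-pos B
                                (proj₂ (nullz δ 0<δ) i (weaken (ℕ.m≤n⊔m M N) t)) ⟩
        B * δ              ≡⟨ Bδ≡ε ⟩
        ε                  ∎
        where open ℚ.≤-Reasoning

  open module N₁ = Null {ℕ} _≤ⁿ_ ℕ.≤-trans using () renaming (IsNull to Null₁)
  open module N₂ = Null {ℕ × ℕ} (λ N (m , n) → N ≤ⁿ m × N ≤ⁿ n)
    (λ M≤N (p , q) → ℕ.≤-trans M≤N p , ℕ.≤-trans M≤N q)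
    using () renaming (IsNull to Null₂)

  difference : (ℕ → ℚ) → ℕ × ℕ → ℚ
  difference s (m , n) = s m - s n

  fromNull₂ : ∀ s → Null₂ (difference s) → IsCauchy s
  fromNull₂ s h ε 0<ε with N , f ← h ε 0<ε = N , λ m n p q → f (m , n) (p , q)

  toNull₂ : ∀ x → Null₂ (difference (seq x))
  toNull₂ x ε 0<ε with N , f ← cauchy x ε 0<ε = N , λ (m , n) (p , q) → f m n p q

  bounded : ∀ x → N₁.Bounded (seq x)
  bounded x with N , f ← cauchy x 1ℚ (positive⁻¹ 1ℚ) =
    ∣ seq x N ∣ + 1ℚ , 0<B , N , λ n N≤n → begin-strict
      ∣ seq x n ∣                          ≡⟨ cong ∣_∣ (split (seq x n) (seq x N)) ⟩
      ∣ seq x N + (seq x n - seq x N) ∣    ≤⟨ ℚ.∣p+q∣≤∣p∣+∣q∣ (seq x N) _ ⟩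
      ∣ seq x N ∣ + ∣ seq x n - seq x N ∣  <⟨ ℚ.+-monoʳ-< ∣ seq x N ∣ (f n N N≤n ℕ.≤-refl) ⟩
      ∣ seq x N ∣ + 1ℚ                     ∎
    where
    open ℚ.≤-Reasoning
    split : ∀ p q → p ≡ q + (p - q)
    split p q = trans (sym (xyx⁻¹≈y q p)) (ℚ.+-assoc q p (- q))
    0<B : 0ℚ < ∣ seq x N ∣ + 1ℚ
    0<B = ℚ.+-mono-≤-< (ℚ.0≤∣p∣ (seq x N)) (positive⁻¹ 1ℚ)

  bounded-fst : ∀ x → N₂.Bounded (seq x ∘ proj₁)
  bounded-fst x with B , 0<B , N , f ← bounded x = B , 0<B , N , λ (m , _) (p , _) → f m p

  bounded-snd : ∀ x → N₂.Bounded (seq x ∘ proj₂)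
  bounded-snd x with B , 0<B , N , f ← bounded x = B , 0<B , N , λ (_ , n) (_ , q) → f n q

  +-difference : ∀ p q r s → (p - q) + (r - s) ≡ (p + r) - (q + s)
  +-difference p q r s = trans (interchange p (- q) r (- s))
    (cong (p + r +_) (sym (ℚ.neg-distrib-+ q s)))

  telescope : ∀ p q r → (p - q) + (q - r) ≡ p - r
  telescope p q r = trans (ℚ.+-assoc p (- q) (q - r))
    (cong (p +_) (trans (sym (ℚ.+-assoc (- q) q (- r)))
      (trans (cong (_- r) (ℚ.+-inverseˡ q)) (ℚ.+-identityˡ (- r)))))

  *-difference : ∀ p q r s → p * (r - s) + s * (p - q) ≡ p * r - q * s
  *-difference p q r s = trans
    (cong₂ _+_ (x[y-z]≈xy-xz p r s)
               (trans (x[y-z]≈xy-xz s p q) (cong₂ _-_ (ℚ.*-comm s p) (ℚ.*-comm s q))))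
    (telescope (p * r) (p * s) (q * s))

infixl 6 _+ʳ_
infixl 7 _*ʳ_
infix  8 -ʳ_

constant : ℚ → ℝ
constant q = mkℝ s (fromNull₂ s (N₂.null-0 (difference s) (λ _ → ℚ.+-inverseʳ q)))
  where
  s : ℕ → ℚ
  s _ = q

0ʳ 1ʳ : ℝ
0ʳ = constant 0ℚ
1ʳ = constant 1ℚ

_+ʳ_ : ℝ → ℝ → ℝ
x +ʳ y = mkℝ s (fromNull₂ s (N₂.null-≗ (λ i → Δx i + Δy i) (difference s)
    (λ (m , n) → +-difference (seq x m) (seq x n) (seq y m) (seq y n))
    (N₂.null-+ Δx Δy (toNull₂ x) (toNull₂ y))))
  where
  s : ℕ → ℚ
  s n = seq x n + seq y n
  Δx Δy : ℕ × ℕ → ℚ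
  Δx = difference (seq x)
  Δy = difference (seq y)

_*ʳ_ : ℝ → ℝ → ℝ
x *ʳ y = mkℝ s (fromNull₂ s (N₂.null-≗ (λ i → xΔy i + yΔx i) (difference s)
    (λ (m , n) → *-difference (seq x m) (seq x n) (seq y m) (seq y n))
    (N₂.null-+ xΔy yΔx
      (N₂.null-* (seq x ∘ proj₁) (difference (seq y)) (bounded-fst x) (toNull₂ y))
      (N₂.null-* (seq y ∘ proj₂) (difference (seq x)) (bounded-snd y) (toNull₂ x)))))
  where
  s : ℕ → ℚ
  s n = seq x n * seq y n
  xΔy yΔx : ℕ × ℕ → ℚ
  xΔy (m , n) = seq x m * (seq y m - seq y n)
  yΔx (m , n) = seq y n * (seq x m - seq x n)

-ʳ_ : ℝ → ℝ
-ʳ x = mkℝ s (fromNull₂ s (N₂.null-≗ (λ i → - Δx i) (difference s)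
    (λ (m , n) → ℚ.neg-distrib-+ (seq x m) (- seq x n))
    (N₂.null-neg Δx (toNull₂ x))))
  where
  s : ℕ → ℚ
  s n = - seq x n
  Δx : ℕ × ℕ → ℚ
  Δx = difference (seq x)

private
  infixl 6 _⊖_

  _⊖_ : ℝ → ℝ → ℕ → ℚ
  (x ⊖ y) n = seq x n - seq y n

  ≗⇒≈ : ∀ x y → (∀ n → seq x n ≡ seq y n) → x ≈ʳ y
  ≗⇒≈ x y eq = N₁.null-0 (x ⊖ y) λ n →
    trans (cong (_- seq y n) (eq n)) (ℚ.+-inverseʳ (seq y n))

  ≈-sym : ∀ x y → x ≈ʳ y → y ≈ʳ x
  ≈-sym x y x≈y = N₁.null-≗ (λ n → - (x ⊖ y) n) (y ⊖ x)
    (λ n → ⁻¹-anti-homo‿- (seq x n) (seq y n)) (N₁.null-neg (x ⊖ y) x≈y)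

  ≈-trans : ∀ x y z → x ≈ʳ y → y ≈ʳ z → x ≈ʳ z
  ≈-trans x y z x≈y y≈z = N₁.null-≗ (λ n → (x ⊖ y) n + (y ⊖ z) n) (x ⊖ z)
    (λ n → telescope (seq x n) (seq y n) (seq z n))
    (N₁.null-+ (x ⊖ y) (y ⊖ z) x≈y y≈z)

  +ʳ-cong : ∀ x y u v → x ≈ʳ y → u ≈ʳ v → (x +ʳ u) ≈ʳ (y +ʳ v)
  +ʳ-cong x y u v x≈y u≈v =
    N₁.null-≗ (λ n → (x ⊖ y) n + (u ⊖ v) n) ((x +ʳ u) ⊖ (y +ʳ v))
      (λ n → +-difference (seq x n) (seq y n) (seq u n) (seq v n))
      (N₁.null-+ (x ⊖ y) (u ⊖ v) x≈y u≈v)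

  *ʳ-cong : ∀ x y u v → x ≈ʳ y → u ≈ʳ v → (x *ʳ u) ≈ʳ (y *ʳ v)
  *ʳ-cong x y u v x≈y u≈v =
    N₁.null-≗ (λ n → seq x n * (u ⊖ v) n + seq v n * (x ⊖ y) n) ((x *ʳ u) ⊖ (y *ʳ v))
      (λ n → *-difference (seq x n) (seq y n) (seq u n) (seq v n))
      (N₁.null-+ (λ n → seq x n * (u ⊖ v) n) (λ n → seq v n * (x ⊖ y) n)
        (N₁.null-* (seq x) (u ⊖ v) (bounded x) u≈v)
        (N₁.null-* (seq v) (x ⊖ y) (bounded v) x≈y))

  -ʳ-cong : ∀ x y → x ≈ʳ y → (-ʳ x) ≈ʳ (-ʳ y)
  -ʳ-cong x y x≈y = N₁.null-≗ (λ n → - (x ⊖ y) n) ((-ʳ x) ⊖ (-ʳ y))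
    (λ n → ℚ.neg-distrib-+ (seq x n) (- seq y n)) (N₁.null-neg (x ⊖ y) x≈y)

ℝ-commutativeRing : CommutativeRing Level.zero Level.zero
ℝ-commutativeRing = record
  { Carrier = ℝ
  ; _≈_ = _≈ʳ_
  ; _+_ = _+ʳ_
  ; _*_ = _*ʳ_
  ; -_ = -ʳ_
  ; 0# = 0ʳ
  ; 1# = 1ʳ
  ; isCommutativeRing = record
    { isRing = record
      { +-isAbelianGroup = record
        { isGroup = record
          { isMonoid = record
            { isSemigroup = record
              { isMagma = record
                { isEquivalence = record
                  { refl = λ {x} → ≗⇒≈ x x (λ _ → refl)
                  ; sym = λ {x} {y} → ≈-sym x y
                  ; trans = λ {x} {y} {z} → ≈-trans x y z
                  }
                ; ∙-cong = λ {x} {y} {u} {v} → +ʳ-cong x y u v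
                }
              ; assoc = λ x y z → ≗⇒≈ ((x +ʳ y) +ʳ z) (x +ʳ (y +ʳ z))
                  (λ n → ℚ.+-assoc (seq x n) (seq y n) (seq z n))
              }
            ; identity = (λ x → ≗⇒≈ (0ʳ +ʳ x) x (λ n → ℚ.+-identityˡ (seq x n)))
                       , (λ x → ≗⇒≈ (x +ʳ 0ʳ) x (λ n → ℚ.+-identityʳ (seq x n)))
            }
          ; inverse = (λ x → ≗⇒≈ ((-ʳ x) +ʳ x) 0ʳ (λ n → ℚ.+-inverseˡ (seq x n)))
                    , (λ x → ≗⇒≈ (x +ʳ (-ʳ x)) 0ʳ (λ n → ℚ.+-inverseʳ (seq x n)))
          ; ⁻¹-cong = λ {x} {y} → -ʳ-cong x y
          }
        ; comm = λ x y → ≗⇒≈ (x +ʳ y) (y +ʳ x) (λ n → ℚ.+-comm (seq x n) (seq y n))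
        }
      ; *-cong = λ {x} {y} {u} {v} → *ʳ-cong x y u v
      ; *-assoc = λ x y z → ≗⇒≈ ((x *ʳ y) *ʳ z) (x *ʳ (y *ʳ z))
          (λ n → ℚ.*-assoc (seq x n) (seq y n) (seq z n))
      ; *-identity = (λ x → ≗⇒≈ (1ʳ *ʳ x) x (λ n → ℚ.*-identityˡ (seq x n)))
                   , (λ x → ≗⇒≈ (x *ʳ 1ʳ) x (λ n → ℚ.*-identityʳ (seq x n)))
      ; distrib = (λ x y z → ≗⇒≈ (x *ʳ (y +ʳ z)) ((x *ʳ y) +ʳ (x *ʳ z))
                     (λ n → ℚ.*-distribˡ-+ (seq x n) (seq y n) (seq z n)))
                , (λ x y z → ≗⇒≈ ((y +ʳ z) *ʳ x) ((y *ʳ x) +ʳ (z *ʳ x))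
                     (λ n → ℚ.*-distribʳ-+ (seq x n) (seq y n) (seq z n)))
      }
    ; *-comm = λ x y → ≗⇒≈ (x *ʳ y) (y *ʳ x) (λ n → ℚ.*-comm (seq x n) (seq y n))
    }
  }

IsFiniteSetoid : ∀ {a ℓ} → Setoid a ℓ → Set (a ⊔ˡ ℓ)
IsFiniteSetoid S = ∃ λ n → Inverse S (setoid (Fin n))

module _ {c ℓ} (Γ : Group c ℓ) where
  open Group Γ

  record IsSubgroup {p} (P : Pred Carrier p) : Set (c ⊔ˡ ℓ ⊔ˡ p) where
    field
      resp-≈    : ∀ {x y} → x ≈ y → x ∈ P → y ∈ P
      ε-closed  : ε ∈ P
      ∙-closed  : ∀ {x y} → x ∈ P → y ∈ P → (x ∙ y) ∈ P
      ⁻¹-closed : ∀ {x} → x ∈ P → (x ⁻¹) ∈ P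

  data Generated {p} (S : Pred Carrier p) : Pred Carrier (c ⊔ˡ ℓ ⊔ˡ p) where
    generator : ∀ {x} → x ∈ S → x ∈ Generated S
    resp-≈    : ∀ {x y} → x ≈ y → x ∈ Generated S → y ∈ Generated S
    ε-closed  : ε ∈ Generated S
    ∙-closed  : ∀ {x y} → x ∈ Generated S → y ∈ Generated S → (x ∙ y) ∈ Generated S
    ⁻¹-closed : ∀ {x} → x ∈ Generated S → (x ⁻¹) ∈ Generated S

  subsetSetoid : ∀ {p} → Pred Carrier p → Setoid (c ⊔ˡ p) ℓ
  subsetSetoid P = record
    { Carrier = ∃ P
    ; _≈_ = λ x y → proj₁ x ≈ proj₁ y
    ; isEquivalence = record
      { refl = Group.refl Γ ; sym = Group.sym Γ ; trans = Group.trans Γ }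
    }

  image : ∀ {a} {A : Set a} → (A → Carrier) → Pred Carrier (a ⊔ˡ ℓ)
  image f x = ∃ λ a → f a ≈ x

-- Everything here is meaningful over any commutative ring; only K = ℝ is
-- exported at the end.  A linear group is a predicate on the elements of GL U.
module LinearAlgebra {k ℓk} (K : CommutativeRing k ℓk) where

  private module K = CommutativeRing K

  module _ {m ℓ} (U : Module K m ℓ) where
    open Module U
    open Sum +ᴹ-commutativeMonoid using (sum)

    record IsBasis {d} (b : Vector Carrierᴹ d) : Set (k ⊔ˡ ℓk ⊔ˡ m ⊔ˡ ℓ) where
      field
        independent : ∀ (a : Vector K.Carrier d) →
                      sum (λ i → a i *ₗ b i) ≈ᴹ 0ᴹ → ∀ i → a i K.≈ K.0#
        spanning    : ∀ u → ∃ λ (a : Vector K.Carrier d) → sum (λ i → a i *ₗ b i) ≈ᴹ u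

    HasDimension : ℕ → Set (k ⊔ˡ ℓk ⊔ˡ m ⊔ˡ ℓ)
    HasDimension d = ∃ λ (b : Vector Carrierᴹ d) → IsBasis b

    record LinearAutomorphism : Set (k ⊔ˡ m ⊔ˡ ℓ) where
      field
        ⟦_⟧                 : Carrierᴹ → Carrierᴹ
        isModuleIsomorphism : IsModuleIsomorphism rawModule rawModule ⟦_⟧

      open IsModuleIsomorphism isModuleIsomorphism public

    open LinearAutomorphism

    private
      inverse : LinearAutomorphism → Carrierᴹ → Carrierᴹ
      inverse φ u = proj₁ (surjective φ u)

      inverseʳ : ∀ φ u → ⟦ φ ⟧ (inverse φ u) ≈ᴹ u
      inverseʳ φ u = proj₂ (surjective φ u) ≈ᴹ-refl

      to-inverse : ∀ φ {u v} → ⟦ φ ⟧ v ≈ᴹ u → inverse φ u ≈ᴹ v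
      to-inverse φ φv≈u = injective φ (≈ᴹ-trans (inverseʳ φ _) (≈ᴹ-sym φv≈u))

      inverse-cong : ∀ φ {u v} → u ≈ᴹ v → inverse φ u ≈ᴹ inverse φ v
      inverse-cong φ u≈v = to-inverse φ (≈ᴹ-trans (inverseʳ φ _) (≈ᴹ-sym u≈v))

    _⁻¹ : LinearAutomorphism → LinearAutomorphism
    φ ⁻¹ = record
      { ⟦_⟧ = inverse φ
      ; isModuleIsomorphism = record
        { isModuleMonomorphism = record
          { isModuleHomomorphism = record
            { isBimoduleHomomorphism = record
              { +ᴹ-isGroupHomomorphism = record
                { isMonoidHomomorphism = record
                  { isMagmaHomomorphism = record
                    { isRelHomomorphism = record { cong = inverse-cong φ }
                    ; homo = λ u v → to-inverse φ
                        (≈ᴹ-trans (+ᴹ-homo φ _ _) (+ᴹ-cong (inverseʳ φ u) (inverseʳ φ v)))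
                    }
                  ; ε-homo = to-inverse φ (0ᴹ-homo φ)
                  }
                ; ⁻¹-homo = λ u → to-inverse φ
                    (≈ᴹ-trans (-ᴹ-homo φ _) (-ᴹ‿cong (inverseʳ φ u)))
                }
              ; *ₗ-homo = λ a u → to-inverse φ
                  (≈ᴹ-trans (*ₗ-homo φ a _) (*ₗ-cong K.refl (inverseʳ φ u)))
              ; *ᵣ-homo = λ a u → to-inverse φ
                  (≈ᴹ-trans (*ᵣ-homo φ a _) (*ᵣ-cong (inverseʳ φ u) K.refl))
              }
            }
          ; injective = λ {u} {v} eq → ≈ᴹ-trans (≈ᴹ-sym (inverseʳ φ u))
              (≈ᴹ-trans (⟦⟧-cong φ eq) (inverseʳ φ v))
          }
        ; surjective = λ u → ⟦ φ ⟧ u , λ eq → to-inverse φ (≈ᴹ-sym eq)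
        }
      }

    GL : Group (k ⊔ˡ m ⊔ˡ ℓ) (m ⊔ˡ ℓ)
    GL = record
      { Carrier = LinearAutomorphism
      ; _≈_ = λ φ ψ → ∀ u → ⟦ φ ⟧ u ≈ᴹ ⟦ ψ ⟧ u
      ; _∙_ = λ φ ψ → record
          { ⟦_⟧ = ⟦ φ ⟧ ∘ ⟦ ψ ⟧
          ; isModuleIsomorphism = Composition.isModuleIsomorphism ≈ᴹ-trans
              (isModuleIsomorphism ψ) (isModuleIsomorphism φ)
          }
      ; ε = record
          { ⟦_⟧ = id
          ; isModuleIsomorphism = Identity.isModuleIsomorphism rawModule ≈ᴹ-refl
          }
      ; _⁻¹ = _⁻¹
      ; isGroup = record
        { isMonoid = record
          { isSemigroup = record
            { isMagma = record
              { isEquivalence = record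
                { refl = λ _ → ≈ᴹ-refl
                ; sym = λ eq u → ≈ᴹ-sym (eq u)
                ; trans = λ eq eq′ u → ≈ᴹ-trans (eq u) (eq′ u)
                }
              ; ∙-cong = λ {φ} {_} {_} {ψ′} eq eq′ u →
                  ≈ᴹ-trans (⟦⟧-cong φ (eq′ u)) (eq (⟦ ψ′ ⟧ u))
              }
            ; assoc = λ _ _ _ _ → ≈ᴹ-refl
            }
          ; identity = (λ _ _ → ≈ᴹ-refl) , (λ _ _ → ≈ᴹ-refl)
          }
        ; inverse = (λ φ _ → to-inverse φ ≈ᴹ-refl) , (λ φ u → inverseʳ φ u)
        ; ⁻¹-cong = λ {φ} {ψ} eq u → to-inverse φ
            (≈ᴹ-trans (eq (inverse ψ u)) (inverseʳ ψ u))
        }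
      }

    fixedSpace : LinearAutomorphism → Module K (m ⊔ˡ ℓ) ℓ
    fixedSpace φ = record
      { isModule = ModuleMonomorphism.isModule
          {M = record
            { Carrierᴹ = ∃ λ u → ⟦ φ ⟧ u ≈ᴹ u
            ; _≈ᴹ_ = λ u v → proj₁ u ≈ᴹ proj₁ v
            ; _+ᴹ_ = λ (u , p) (v , q) → u +ᴹ v , ≈ᴹ-trans (+ᴹ-homo φ u v) (+ᴹ-cong p q)
            ; _*ₗ_ = λ a (u , p) → a *ₗ u , ≈ᴹ-trans (*ₗ-homo φ a u) (*ₗ-cong K.refl p)
            ; _*ᵣ_ = λ (u , p) a → u *ᵣ a , ≈ᴹ-trans (*ᵣ-homo φ a u) (*ᵣ-cong p K.refl)
            ; 0ᴹ = 0ᴹ , 0ᴹ-homo φ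
            ; -ᴹ_ = λ (u , p) → -ᴹ u , ≈ᴹ-trans (-ᴹ-homo φ u) (-ᴹ‿cong p)
            }}
          {N = rawModule} {⟦_⟧ = proj₁}
          (record
            { isModuleHomomorphism = record
              { isBimoduleHomomorphism = record
                { +ᴹ-isGroupHomomorphism = record
                  { isMonoidHomomorphism = record
                    { isMagmaHomomorphism = record
                      { isRelHomomorphism = record { cong = id }
                      ; homo = λ _ _ → ≈ᴹ-refl
                      }
                    ; ε-homo = ≈ᴹ-refl
                    }
                  ; ⁻¹-homo = λ _ → ≈ᴹ-refl
                  }
                ; *ₗ-homo = λ _ _ → ≈ᴹ-refl
                ; *ᵣ-homo = λ _ _ → ≈ᴹ-refl
                }
              }
            ; injective = id
            })
          K.isCommutativeRing isModule
      }

  module _ {m ℓ} (U : Module K m ℓ) where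

    -- codim U^⟨φ⟩ = j, read as dim U^⟨φ⟩ + j = dim U.
    FixedSpaceHasCodimension : ℕ → Pred (LinearAutomorphism U) (k ⊔ˡ ℓk ⊔ˡ m ⊔ˡ ℓ)
    FixedSpaceHasCodimension j φ = ∃₂ λ d e →
      HasDimension U d × HasDimension (fixedSpace U φ) e × e ℕ.+ j ≡ d

    record IsFiniteLinearGroup {p} (G : Pred (LinearAutomorphism U) p) :
                               Set (k ⊔ˡ m ⊔ˡ ℓ ⊔ˡ p) where
      field
        isSubgroup : IsSubgroup (GL U) G
        isFinite   : IsFiniteSetoid (subsetSetoid (GL U) G)

    StrictlyGeneratedInCodimension : ∀ {p} → ℕ → Pred (LinearAutomorphism U) p →
                                     Set (k ⊔ˡ ℓk ⊔ˡ m ⊔ˡ ℓ ⊔ˡ p)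
    StrictlyGeneratedInCodimension j G =
      G ≐ Generated (GL U) (G ∩ FixedSpaceHasCodimension j)

  IsFaithfulRepresentation : ∀ {c ℓ m ℓm} (Γ : Group c ℓ) (U : Module K m ℓm) →
                             (Group.Carrier Γ → LinearAutomorphism U) →
                             Set (c ⊔ˡ ℓ ⊔ˡ m ⊔ˡ ℓm)
  IsFaithfulRepresentation Γ U = IsGroupMonomorphism (Group.rawGroup Γ) (Group.rawGroup (GL U))

  infixr 8 _^_

  _^_ : ∀ {m ℓ} → Module K m ℓ → ℕ → Module K m ℓ
  V ^ n = record
    { Carrierᴹ = Vector Carrierᴹ n
    ; _≈ᴹ_ = λ u v → ∀ i → u i ≈ᴹ v i
    ; _+ᴹ_ = λ u v i → u i +ᴹ v i
    ; _*ₗ_ = λ a u i → a *ₗ u i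
    ; _*ᵣ_ = λ u a i → u i *ᵣ a
    ; 0ᴹ = λ _ → 0ᴹ
    ; -ᴹ_ = λ u i → -ᴹ u i
    ; isModule = record
      { isBimodule = record
        { isBisemimodule = record
          { +ᴹ-isCommutativeMonoid = V^n.isCommutativeMonoid
          ; isPreleftSemimodule = record
            { *ₗ-cong = λ a≈b u≈v i → *ₗ-cong a≈b (u≈v i)
            ; *ₗ-zeroˡ = λ u i → *ₗ-zeroˡ (u i)
            ; *ₗ-distribʳ = λ u a b i → *ₗ-distribʳ (u i) a b
            ; *ₗ-identityˡ = λ u i → *ₗ-identityˡ (u i)
            ; *ₗ-assoc = λ a b u i → *ₗ-assoc a b (u i)
            ; *ₗ-zeroʳ = λ a i → *ₗ-zeroʳ a
            ; *ₗ-distribˡ = λ a u v i → *ₗ-distribˡ a (u i) (v i)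
            }
          ; isPrerightSemimodule = record
            { *ᵣ-cong = λ u≈v a≈b i → *ᵣ-cong (u≈v i) a≈b
            ; *ᵣ-zeroʳ = λ u i → *ᵣ-zeroʳ (u i)
            ; *ᵣ-distribˡ = λ u a b i → *ᵣ-distribˡ (u i) a b
            ; *ᵣ-identityʳ = λ u i → *ᵣ-identityʳ (u i)
            ; *ᵣ-assoc = λ u a b i → *ᵣ-assoc (u i) a b
            ; *ᵣ-zeroˡ = λ a i → *ᵣ-zeroˡ a
            ; *ᵣ-distribʳ = λ a u v i → *ᵣ-distribʳ a (u i) (v i)
            }
          ; *ₗ-*ᵣ-assoc = λ a u b i → *ₗ-*ᵣ-assoc a (u i) b
          }
        ; -ᴹ‿cong = V^n.⁻¹-cong
        ; -ᴹ‿inverse = V^n.inverse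
        }
      ; *ₗ-*ᵣ-coincident = λ a u i → *ₗ-*ᵣ-coincident a (u i)
      }
    }
    where
    open Module V
    module V^n = IsAbelianGroup
      (AbelianGroup.isAbelianGroup (pointwiseAbelianGroup (Fin n) +ᴹ-abelianGroup))

  diagonal : ∀ {m ℓ} (V : Module K m ℓ) n → LinearAutomorphism V → LinearAutomorphism (V ^ n)
  diagonal V n φ = record
    { ⟦_⟧ = λ u i → ⟦ u i ⟧
    ; isModuleIsomorphism = record
      { isModuleMonomorphism = record
        { isModuleHomomorphism = record
          { isBimoduleHomomorphism = record
            { +ᴹ-isGroupHomomorphism = record
              { isMonoidHomomorphism = record
                { isMagmaHomomorphism = record
                  { isRelHomomorphism = record { cong = λ eq i → ⟦⟧-cong (eq i) }
                  ; homo = λ u v i → +ᴹ-homo (u i) (v i)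
                  }
                ; ε-homo = λ _ → 0ᴹ-homo
                }
              ; ⁻¹-homo = λ u i → -ᴹ-homo (u i)
              }
            ; *ₗ-homo = λ a u i → *ₗ-homo a (u i)
            ; *ᵣ-homo = λ a u i → *ᵣ-homo a (u i)
            }
          }
        ; injective = λ eq i → injective (eq i)
        }
      ; surjective = λ u → (λ i → proj₁ (surjective (u i)))
                         , (λ eq i → proj₂ (surjective (u i)) (eq i))
      }
    }
    where open LinearAutomorphism φ

open LinearAlgebra ℝ-commutativeRing public

RealVectorSpace : ∀ m ℓ → Set (lsuc (m ⊔ˡ ℓ))
RealVectorSpace = Module ℝ-commutativeRing

{-# OPTIONS --safe #-}

-- If b is a basis of V, the vectors with b j in slot i and 0 elsewhere form a
-- basis of V ^ n; so dim (V ^ n) = dim V * n.  A vector of V ^ n is fixed by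
-- diagonal φ iff its components are fixed by φ, so the same count applied to
-- (V^⟨φ⟩) ^ n shows that diagonal multiplies codimensions of fixed spaces by
-- n.  As diagonal is a group homomorphism, it maps a word in the codimension 2
-- generators of ρ(G) to a word in elements of codimension 2n.
module Submission where

open import Algebra.Bundles using (CommutativeMonoid; CommutativeRing; Group; Monoid)
open import Algebra.Module.Bundles using (Module)
open import Algebra.Module.Morphism.Structures using (IsModuleIsomorphism)
import Algebra.Morphism.Construct.Composition as Composition
open import Algebra.Morphism.Structures
  using (IsGroupHomomorphism; IsGroupMonomorphism; IsMonoidHomomorphism)
import Algebra.Properties.CommutativeMonoid.Sum as CommutativeSum
import Algebra.Properties.Monoid.Sum as Sum
open import Data.Fin.Base using (Fin; zero; suc; combine; remQuot; punchIn; _↑ˡ_; _↑ʳ_)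
open import Data.Fin.Properties using (combine-remQuot; remQuot-combine; punchInᵢ≢i)
open import Data.Nat.Base using (ℕ; zero; suc; _+_; _*_; _≤_)
import Data.Nat.Properties as ℕ
open import Data.Product.Base using (_×_; _,_; proj₁; proj₂)
open import Data.Vec.Functional using (Vector; replicate; updateAt)
open import Data.Vec.Functional.Properties using (updateAt-minimal; updateAt-updates)
open import Function.Base using (_∘_; const)
open import Function.Bundles using (Inverse)
open import Function.Construct.Composition using () renaming (inverse to _⟨∘⟩_)
open import Relation.Binary.PropositionalEquality.Core as ≡ using (_≡_; _≢_)
import Relation.Binary.Reasoning.Setoid as SetoidReasoning
open import Relation.Unary using (Pred; _∈_; _⊆_)
import Defs
open Defs using
  (IsFiniteSetoid; IsSubgroup; Generated; generator; resp-≈; ε-closed; ∙-closed; ⁻¹-closed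
  ; subsetSetoid; image)

-- Finite sums in monoids.

module _ {a ℓ} (M : Monoid a ℓ) where
  open Monoid M
  open Sum M using (sum)

  sum-++ : ∀ m {n} (f : Vector Carrier (m + n)) →
           sum f ≈ sum (f ∘ (_↑ˡ n)) ∙ sum (f ∘ (m ↑ʳ_))
  sum-++ zero    f = sym (identityˡ _)
  sum-++ (suc m) f = trans (∙-congˡ (sum-++ m (f ∘ suc))) (sym (assoc _ _ _))

  -- `combine` makes its first argument the major index, so the indices with first component `zero`
  -- form exactly the initial block of length `n` that `sum-++` splits off.
  sum-combine : ∀ m {n} (f : Vector Carrier (m * n)) →
                sum f ≈ sum (λ (j : Fin m) → sum (λ (i : Fin n) → f (combine j i)))
  sum-combine zero        f = refl
  sum-combine (suc m) {n} f =
    trans (sum-++ n f) (∙-congˡ (sum-combine m (f ∘ (n ↑ʳ_))))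

module _ {a ℓ} (M : CommutativeMonoid a ℓ) where
  open CommutativeMonoid M
  open CommutativeSum M using (sum; sum-cong-≋; sum-remove; sum-replicate-zero)

  -- Once `sum-remove` has taken out the term at `i`, the remaining indices are `punchIn i j`, never
  -- `i`, so their terms vanish.
  sum-supported : ∀ {n} (i : Fin n) (f : Vector Carrier n) →
                  (∀ j → j ≢ i → f j ≈ ε) → sum f ≈ f i
  sum-supported {suc n} i f f≈ε = trans (sum-remove {i = i} f) (trans
    (∙-congˡ (trans (sum-cong-≋ (λ j → f≈ε (punchIn i j) (punchInᵢ≢i i j)))
                    (sum-replicate-zero n)))
    (identityʳ (f i)))

module _ {a ℓ b ℓ′} (M : Monoid a ℓ) (N : Monoid b ℓ′) where
  private
    module M = Monoid M
    module N = Monoid N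

  sum-homo : ∀ {h} → IsMonoidHomomorphism M.rawMonoid N.rawMonoid h →
             ∀ {n} (f : Vector M.Carrier n) → h (Sum.sum M f) N.≈ Sum.sum N (h ∘ f)
  sum-homo hom {zero}  f = IsMonoidHomomorphism.ε-homo hom
  sum-homo hom {suc n} f = N.trans (IsMonoidHomomorphism.homo hom _ _)
    (N.∙-congˡ (sum-homo hom (f ∘ suc)))

-- Generated subgroups and images of homomorphisms.

module _ {c ℓ} (Γ : Group c ℓ) where

  Generated-⊆ : ∀ {p q} {S : Pred (Group.Carrier Γ) p} {P : Pred (Group.Carrier Γ) q} →
                IsSubgroup Γ P → S ⊆ P → Generated Γ S ⊆ P
  Generated-⊆ P-sub S⊆P = go
    where
    module P = IsSubgroup P-sub
    go : Generated Γ _ ⊆ _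
    go (generator x∈S)  = S⊆P x∈S
    go (resp-≈ x≈y x∈)  = P.resp-≈ x≈y (go x∈)
    go ε-closed         = P.ε-closed
    go (∙-closed x∈ y∈) = P.∙-closed (go x∈) (go y∈)
    go (⁻¹-closed x∈)   = P.⁻¹-closed (go x∈)

module _ {c ℓ d ℓ′} (Γ : Group c ℓ) (Δ : Group d ℓ′)
         (f : Group.Carrier Γ → Group.Carrier Δ) where
  private
    module Γ = Group Γ
    module Δ = Group Δ

  module _ (hom : IsGroupHomomorphism Γ.rawGroup Δ.rawGroup f) where
    open IsGroupHomomorphism hom

    image-isSubgroup : IsSubgroup Δ (image Δ f)
    image-isSubgroup = record
      { resp-≈    = λ x≈y (g , fg≈x) → g , Δ.trans fg≈x x≈y
      ; ε-closed  = Γ.ε , ε-homo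
      ; ∙-closed  = λ (g , fg≈x) (h , fh≈y) →
          g Γ.∙ h , Δ.trans (homo g h) (Δ.∙-cong fg≈x fh≈y)
      ; ⁻¹-closed = λ (g , fg≈x) → g Γ.⁻¹ , Δ.trans (⁻¹-homo g) (Δ.⁻¹-cong fg≈x)
      }

    -- Induction on words. The operations are preserved only up to `≈`, so each closure rule is
    -- carried over and then corrected by `resp-≈`.
    Generated-map : ∀ {p q} {S : Pred Γ.Carrier p} {T : Pred Δ.Carrier q} →
                    (∀ {x} → x ∈ S → f x ∈ T) →
                    ∀ {x} → x ∈ Generated Γ S → f x ∈ Generated Δ T
    Generated-map S⇒T (generator x∈S)  = generator (S⇒T x∈S)
    Generated-map S⇒T (resp-≈ x≈y x∈)  = resp-≈ (⟦⟧-cong x≈y) (Generated-map S⇒T x∈)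
    Generated-map S⇒T ε-closed         = resp-≈ (Δ.sym ε-homo) ε-closed
    Generated-map S⇒T (∙-closed x∈ y∈) =
      resp-≈ (Δ.sym (homo _ _)) (∙-closed (Generated-map S⇒T x∈) (Generated-map S⇒T y∈))
    Generated-map S⇒T (⁻¹-closed x∈)   =
      resp-≈ (Δ.sym (⁻¹-homo _)) (⁻¹-closed (Generated-map S⇒T x∈))

  module _ (mono : IsGroupMonomorphism Γ.rawGroup Δ.rawGroup f) where
    open IsGroupMonomorphism mono

    -- A membership proof carries a preimage, and injectivity makes this choice respect equality.
    -- This moves finiteness from `Γ` to the image.
    image-↔ : Inverse (subsetSetoid Δ (image Δ f)) Γ.setoid
    image-↔ = record
      { to        = λ (_ , g , _) → g
      ; from      = λ g → f g , g , Δ.refl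
      ; to-cong   = λ { {_ , _ , fg≈x} {_ , _ , fh≈y} x≈y →
                      injective (Δ.trans fg≈x (Δ.trans x≈y (Δ.sym fh≈y))) }
      ; from-cong = ⟦⟧-cong
      ; inverse   = (λ { {_} {_ , _ , fg≈x} x≈fh → injective (Δ.trans fg≈x x≈fh) })
                  , (λ { {_ , _ , fh≈y} g≈h → Δ.trans (⟦⟧-cong g≈h) fh≈y })
      }

    image-isFinite : IsFiniteSetoid Γ.setoid → IsFiniteSetoid (subsetSetoid Δ (image Δ f))
    image-isFinite (n , Γ↔Fin) = n , (image-↔ ⟨∘⟩ Γ↔Fin)

module _ {k ℓk} (K : CommutativeRing k ℓk) where
  open Defs.LinearAlgebra renaming (_^_ to power)
  private module K = CommutativeRing K

  -- Dimension under isomorphisms and in powers of a module.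

  module _ {m ℓ m′ ℓ′} (U : Module K m ℓ) (W : Module K m′ ℓ′) where
    private
      module U = Module U
      module W = Module W

    -- `h` commutes with linear combinations: injectivity pulls relations back to `b`, and
    -- surjectivity expands a vector through a preimage.
    HasDimension-resp-≅ : ∀ h → IsModuleIsomorphism U.rawModule W.rawModule h →
                          ∀ {d} → HasDimension K U d → HasDimension K W d
    HasDimension-resp-≅ h iso {d} (b , isBasis) = h ∘ b , record
      { independent = λ a eq → independent a
          (injective (W.≈ᴹ-trans (combination a) (W.≈ᴹ-trans eq (W.≈ᴹ-sym 0ᴹ-homo))))
      ; spanning    = λ w → let u , hu≈w = surjective w ; a , eq = spanning u in
          a , W.≈ᴹ-trans (W.≈ᴹ-sym (combination a)) (hu≈w eq)
      }
      where
      open IsModuleIsomorphism iso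
      open IsBasis isBasis

      combination : ∀ a → h (Sum.sum U.+ᴹ-monoid (λ j → a j U.*ₗ b j)) W.≈ᴹ
                          Sum.sum W.+ᴹ-monoid (λ j → a j W.*ₗ h (b j))
      combination a = W.≈ᴹ-trans
        (sum-homo U.+ᴹ-monoid W.+ᴹ-monoid +ᴹ-isMonoidHomomorphism {d} _)
        (Sum.sum-cong-≋ W.+ᴹ-monoid {d} (λ j → *ₗ-homo (a j) (b j)))

  module _ {m ℓ} (V : Module K m ℓ) (n : ℕ) where
    private
      module V = Module V
      module Vⁿ = Module (power K V n)

    -- With `sum-homo`, this lets sums in the power be evaluated slot by slot.
    lookup-isMonoidHomomorphism :
      ∀ i → IsMonoidHomomorphism (Monoid.rawMonoid Vⁿ.+ᴹ-monoid) (Monoid.rawMonoid V.+ᴹ-monoid)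
              (λ u → u i)
    lookup-isMonoidHomomorphism i = record
      { isMagmaHomomorphism = record
        { isRelHomomorphism = record { cong = λ u≈v → u≈v i }
        ; homo = λ _ _ → V.≈ᴹ-refl
        }
      ; ε-homo = V.≈ᴹ-refl
      }

    single : Fin n → V.Carrierᴹ → Vⁿ.Carrierᴹ
    single i v = updateAt (replicate n V.0ᴹ) i (const v)

    powerBasis : ∀ {d} → Vector V.Carrierᴹ d → Vector Vⁿ.Carrierᴹ (d * n)
    powerBasis b l = let j , i = remQuot n l in single i (b j)

    module _ {d} (b : Vector V.Carrierᴹ d) where
      open SetoidReasoning V.≈ᴹ-setoid

      private
        term : Vector K.Carrier (d * n) → Fin n → Fin (d * n) → V.Carrierᴹ
        term a i l = a l V.*ₗ powerBasis b l i

      term-combine : ∀ a i j i′ →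
        term a i (combine j i′) ≡ a (combine j i′) V.*ₗ single i′ (b j) i
      term-combine a i j i′ =
        ≡.cong (λ (j′ , i″) → a (combine j i′) V.*ₗ single i″ (b j′) i) (remQuot-combine j i′)

      -- In row `j` of the double sum, every basis vector supported in a slot other than `i`
      -- contributes zero. A relation in the power thus decouples into one relation in `V` per slot.
      powerBasis-combination : ∀ (a : Vector K.Carrier (d * n)) i →
        Sum.sum Vⁿ.+ᴹ-monoid (λ l → a l Vⁿ.*ₗ powerBasis b l) i V.≈ᴹ
        Sum.sum V.+ᴹ-monoid (λ j → a (combine j i) V.*ₗ b j)
      powerBasis-combination a i = begin
        Sum.sum Vⁿ.+ᴹ-monoid (λ l → a l Vⁿ.*ₗ powerBasis b l) i
          ≈⟨ sum-homo Vⁿ.+ᴹ-monoid V.+ᴹ-monoid (lookup-isMonoidHomomorphism i) {d * n} _ ⟩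
        Sum.sum V.+ᴹ-monoid (term a i)
          ≈⟨ sum-combine V.+ᴹ-monoid d {n} (term a i) ⟩
        Sum.sum V.+ᴹ-monoid (λ (j : Fin d) →
            Sum.sum V.+ᴹ-monoid (λ (i′ : Fin n) → term a i (combine j i′)))
          ≈⟨ Sum.sum-cong-≋ V.+ᴹ-monoid {d} row ⟩
        Sum.sum V.+ᴹ-monoid (λ j → a (combine j i) V.*ₗ b j)
          ∎
        where
        off-diagonal : ∀ j i′ → i′ ≢ i → term a i (combine j i′) V.≈ᴹ V.0ᴹ
        off-diagonal j i′ i′≢i = begin
          term a i (combine j i′)                   ≡⟨ term-combine a i j i′ ⟩
          a (combine j i′) V.*ₗ single i′ (b j) i
            ≡⟨ ≡.cong (a (combine j i′) V.*ₗ_) (updateAt-minimal i i′ _ (i′≢i ∘ ≡.sym)) ⟩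
          a (combine j i′) V.*ₗ V.0ᴹ                ≈⟨ V.*ₗ-zeroʳ _ ⟩
          V.0ᴹ                                      ∎

        row : ∀ j → Sum.sum V.+ᴹ-monoid (λ i′ → term a i (combine j i′)) V.≈ᴹ
                    a (combine j i) V.*ₗ b j
        row j = begin
          Sum.sum V.+ᴹ-monoid (λ i′ → term a i (combine j i′))
            ≈⟨ sum-supported V.+ᴹ-commutativeMonoid i _ (off-diagonal j) ⟩
          term a i (combine j i)                    ≡⟨ term-combine a i j i ⟩
          a (combine j i) V.*ₗ single i (b j) i
            ≡⟨ ≡.cong (a (combine j i) V.*ₗ_) (updateAt-updates i _) ⟩
          a (combine j i) V.*ₗ b j                  ∎

    power-hasDimension : ∀ {d} → HasDimension K V d → HasDimension K (power K V n) (d * n)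
    power-hasDimension {d} (b , isBasis) = powerBasis b , record
      { independent = λ a eq l → let j , i = remQuot n l in
          -- Independence in slot `i` kills the coefficient at `combine j i`, and every `l` has this
          -- form.
          ≡.subst (λ l → a l K.≈ K.0#) (combine-remQuot {d} n l)
            (independent (λ j → a (combine j i))
              (V.≈ᴹ-trans (V.≈ᴹ-sym (powerBasis-combination b a i)) (eq i)) j)
      ; spanning    = λ u →
          -- The coefficient at the pair `(j , i)` is the `j`-th coordinate of `u i` with respect to
          -- `b`.
          let a : Vector K.Carrier (d * n)
              a l = let j , i = remQuot n l in proj₁ (spanning (u i)) j
          in a , λ i → V.≈ᴹ-trans (powerBasis-combination b a i) (V.≈ᴹ-trans
               (V.≈ᴹ-reflexive (Sum.sum-cong-≗ V.+ᴹ-monoid {d} (λ j →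
                 ≡.cong (λ (j′ , i′) → proj₁ (spanning (u i′)) j′ V.*ₗ b j) (remQuot-combine j i))))
               (proj₂ (spanning (u i))))
      }
      where open IsBasis isBasis

  -- Diagonal automorphisms: fixed spaces, codimension and generation.

  module _ {m ℓ} (V : Module K m ℓ) (n : ℕ) where
    private module V = Module V

    -- A family of pairs of a vector and a fixedness proof is regrouped into a pair of families.
    -- Equality ignores the proofs, so the laws hold by reflexivity.
    fixedSpace-diagonal-≅ : (φ : LinearAutomorphism K V) →
      IsModuleIsomorphism (Module.rawModule (power K (fixedSpace K V φ) n))
        (Module.rawModule (fixedSpace K (power K V n) (diagonal K V n φ)))
        (λ u → proj₁ ∘ u , proj₂ ∘ u)
    fixedSpace-diagonal-≅ φ = record
      { isModuleMonomorphism = record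
        { isModuleHomomorphism = record
          { isBimoduleHomomorphism = record
            { +ᴹ-isGroupHomomorphism = record
              { isMonoidHomomorphism = record
                { isMagmaHomomorphism = record
                  { isRelHomomorphism = record { cong = λ u≈v → u≈v }
                  ; homo = λ _ _ _ → V.≈ᴹ-refl
                  }
                ; ε-homo = λ _ → V.≈ᴹ-refl
                }
              ; ⁻¹-homo = λ _ _ → V.≈ᴹ-refl
              }
            ; *ₗ-homo = λ _ _ _ → V.≈ᴹ-refl
            ; *ᵣ-homo = λ _ _ _ → V.≈ᴹ-refl
            }
          }
        ; injective = λ u≈v → u≈v
        }
      ; surjective = λ (u , fixed) → (λ i → u i , fixed i) , λ u≈v → u≈v
      }

    diagonal-codimension : ∀ j φ → FixedSpaceHasCodimension K V j φ →
      FixedSpaceHasCodimension K (power K V n) (j * n) (diagonal K V n φ)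
    diagonal-codimension j φ (d , e , dimV , dimFix , e+j≡d) =
        d * n , e * n
      , power-hasDimension V n dimV
      , HasDimension-resp-≅ (power K (fixedSpace K V φ) n)
          (fixedSpace K (power K V n) (diagonal K V n φ)) (λ u → proj₁ ∘ u , proj₂ ∘ u)
          (fixedSpace-diagonal-≅ φ) (power-hasDimension (fixedSpace K V φ) n dimFix)
      -- The additive form of codimension is simply multiplied by `n`.
      , ≡.trans (≡.sym (ℕ.*-distribʳ-+ n e j)) (≡.cong (_* n) e+j≡d)

    -- Inverses are read off from surjectivity, whose witness for a diagonal map is chosen slotwise;
    -- hence even `⁻¹-homo` is reflexivity.
    diagonal-isGroupHomomorphism :
      IsGroupHomomorphism (Group.rawGroup (GL K V)) (Group.rawGroup (GL K (power K V n)))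
        (diagonal K V n)
    diagonal-isGroupHomomorphism = record
      { isMonoidHomomorphism = record
        { isMagmaHomomorphism = record
          { isRelHomomorphism = record { cong = λ φ≈ψ u i → φ≈ψ (u i) }
          ; homo = λ _ _ _ _ → V.≈ᴹ-refl
          }
        ; ε-homo = λ _ _ → V.≈ᴹ-refl
        }
      ; ⁻¹-homo = λ _ _ _ → V.≈ᴹ-refl
      }

  diagonal-isGroupMonomorphism : ∀ {m ℓ} (V : Module K m ℓ) n →
    IsGroupMonomorphism (Group.rawGroup (GL K V)) (Group.rawGroup (GL K (power K V (suc n))))
      (diagonal K V (suc n))
  diagonal-isGroupMonomorphism V n = record
    { isGroupHomomorphism = diagonal-isGroupHomomorphism V (suc n)
    -- Constant vectors, compared in the first slot, recover the original map; `suc n` guarantees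
    -- that slot.
    ; injective = λ φ≈ψ v → φ≈ψ (const v) zero
    }

  -- One inclusion pushes a word for `ρ g` through `diagonal`; the other holds because the image is
  -- a subgroup containing the generators.
  diagonal-strictlyGenerated : ∀ {c ℓ m ℓm} (Γ : Group c ℓ) (V : Module K m ℓm) n
    (ρ : Group.Carrier Γ → LinearAutomorphism K V) j →
    IsGroupHomomorphism (Group.rawGroup Γ) (Group.rawGroup (GL K (power K V n)))
      (diagonal K V n ∘ ρ) →
    StrictlyGeneratedInCodimension K V j (image (GL K V) ρ) →
    StrictlyGeneratedInCodimension K (power K V n) (j * n)
      (image (GL K (power K V n)) (diagonal K V n ∘ ρ))
  diagonal-strictlyGenerated Γ V n ρ j hom (image⊆generated , _) =
      (λ (g , ρg≈x) → resp-≈ ρg≈x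
        (Generated-map (GL K V) (GL K (power K V n)) (diagonal K V n)
          (diagonal-isGroupHomomorphism V n)
          -- The preimage `h` of a generator `φ` also witnesses that its diagonal lies in the image.
          (λ {φ} ((h , ρh≈φ) , codim) →
            (h , λ u i → ρh≈φ (u i)) , diagonal-codimension V n j φ codim)
          (image⊆generated {ρ g} (g , λ _ → Module.≈ᴹ-refl V))))
    , Generated-⊆ (GL K (power K V n))
        (image-isSubgroup Γ (GL K (power K V n)) (diagonal K V n ∘ ρ) hom) proj₁

-- Assembly for real vector spaces of dimension three.

open Defs

proposition5p4 : ∀ {c ℓ m ℓm} (∣G∣ : Group c ℓ) → IsFiniteSetoid (Group.setoid ∣G∣) →
    (V : RealVectorSpace m ℓm) → HasDimension V 3 →
    (ρ : Group.Carrier ∣G∣ → LinearAutomorphism V) → IsFaithfulRepresentation ∣G∣ V ρ →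
    StrictlyGeneratedInCodimension V 2 (image (GL V) ρ) →
    (n : ℕ) → 1 ≤ n →
    IsFaithfulRepresentation ∣G∣ (V ^ n) (diagonal V n ∘ ρ)
    × IsFiniteLinearGroup (V ^ n) (image (GL (V ^ n)) (diagonal V n ∘ ρ))
    × HasDimension (V ^ n) (3 * n)
    × StrictlyGeneratedInCodimension (V ^ n) (2 * n) (image (GL (V ^ n)) (diagonal V n ∘ ρ))
-- `1 ≤ n` excludes `zero`, leaving the slot from which faithfulness is recovered.
proposition5p4 ∣G∣ finite V dimV ρ faithful generated (suc n) _ =
    faithfulⁿ
  , record
      { isSubgroup = image-isSubgroup ∣G∣ (GL (V ^ suc n)) (diagonal V (suc n) ∘ ρ) homⁿ
      ; isFinite   = image-isFinite ∣G∣ (GL (V ^ suc n)) (diagonal V (suc n) ∘ ρ) faithfulⁿ finite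
      }
  , power-hasDimension ℝ-commutativeRing V (suc n) dimV
  , diagonal-strictlyGenerated ℝ-commutativeRing ∣G∣ V (suc n) ρ 2 homⁿ generated
  where
  faithfulⁿ : IsFaithfulRepresentation ∣G∣ (V ^ suc n) (diagonal V (suc n) ∘ ρ)
  faithfulⁿ = Composition.isGroupMonomorphism
    (λ {φ} {ψ} {χ} → Group.trans (GL (V ^ suc n)) {φ} {ψ} {χ})
    {f = ρ} {g = diagonal V (suc n)} faithful (diagonal-isGroupMonomorphism ℝ-commutativeRing V n)

  homⁿ : IsGroupHomomorphism (Group.rawGroup ∣G∣) (Group.rawGroup (GL (V ^ suc n)))
           (diagonal V (suc n) ∘ ρ)
  homⁿ = IsGroupMonomorphism.isGroupHomomorphism faithfulⁿ
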